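{- None of the tensor product, the lexicographic product, and the strong product of graphs necessarily preserves semi-transitive orientability. That is: (1) there exist finite simple semi-transitively orientable graphs $G,H$ such that the tensor product $G\times H$ is not semi-transitively orientable; (2) there exist finite simple semi-transitively orientable graphs $G,H$ such that the lexicographic product $G\cdot H$ is not semi-transitively orientable; (3) there exist finite simple semi-transitively orientable graphs $G,H$ such that the strong product $G\boxtimes H$ is not semi-transitively orientable.
   Context: Graphs are finite, undirected and simple. An orientation of a graph assigns to each edge one of its two directions; it is acyclic if it has no directed cycle. A digraph is transitive if whenever $v_1\to v_2$ and $v_2\to v_3$ are directed edges on three distinct vertices, $v_1\to v_3$ is also a directed edge. Given an acyclic orientation $\phi$ of a graph $G$, a shortcut in $\phi(G)$ is a non-transitive induced subdigraph of $\phi(G)$ on a vertex set $\{v_1,\dots,v_n\}$ with $n\ge 4$ (distinct vertices) that contains the directed path $v_1\to v_2\to\cdots\to v_n$ and the directed edge $v_1\to v_n$. An acyclic orientation $\phi$ is semi-transitive if $\phi(G)$ contains no shortcut, and a graph is semi-transitively orientable if it has a semi-transitive orientation. All three products have vertex set $V(G)\times V(H)$; writing $\sim$ for adjacency, $(u_1,u_2)\sim(v_1,v_2)$ holds: in the tensor product $G\times H$ iff $u_1\sim v_1$ and $u_2\sim v_2$; in the lexicographic product $G\cdot H$ iff $u_1\sim v_1$, or ($u_1=v_1$ and $u_2\sim v_2$); in the strong product $G\boxtimes H$ iff ($u_1=v_1$ and $u_2\sim v_2$), or ($u_1\sim v_1$ and $u_2=v_2$), or ($u_1\sim v_1$ and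 $u_2\sim v_2$). -}

module Defs where

open import Data.Fin using (Fin; zero; suc; inject₁; fromℕ)
open import Data.Fin.Properties using (*↔×; inj⇒≟)
open import Data.Nat using (ℕ; suc; _*_; _≤_)
open import Data.Product using (Σ; _×_; _,_; proj₁; proj₂)
open import Data.Product.Function.NonDependent.Propositional using (_×-↔_)
open import Data.Sum using (_⊎_; inj₁; inj₂; [_,_]′)
import Data.Sum as Sum
open import Function using (_∘_; _on_)
open import Function.Bundles using (_↔_)
open import Function.Construct.Composition using (_↔-∘_)
open import Function.Construct.Symmetry using (↔-sym)
open import Function.Definitions using (Injective)
open import Function.Properties.Inverse using (Inverse⇒Injection)
open import Level using (0ℓ)
open import Relation.Binary using (Rel; Symmetric; Irreflexive; Decidable; DecidableEquality; Asymmetric)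
open import Relation.Binary.PropositionalEquality using (_≡_; _≢_; refl; sym)
open import Relation.Nullary using (¬_)
open import Relation.Nullary.Decidable using (_×-dec_; _⊎-dec_)

-- Decidability of adjacency is part of being a finite graph constructively
-- (the edge set is a finite set given by listing it); classically it is automatic.
record Graph : Set₁ where
  infix 4 _∼_ _∼?_
  field
    Vertex      : Set
    order       : ℕ
    enumeration : Vertex ↔ Fin order
    _∼_         : Rel Vertex 0ℓ
    _∼?_        : Decidable _∼_
    ∼-sym       : Symmetric _∼_
    ∼-irrefl    : Irreflexive _≡_ _∼_

  infix 4 _≟_
  _≟_ : DecidableEquality Vertex
  _≟_ = inj⇒≟ (Inverse⇒Injection enumeration)

record Orientation (G : Graph) : Set₁ where
  open Graph G
  infix 4 _⟶_
  field
    _⟶_    : Rel Vertex 0ℓ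
    ⟶⇒∼    : ∀ {u v} → u ⟶ v → u ∼ v
    orient : ∀ {u v} → u ∼ v → u ⟶ v ⊎ v ⟶ u
    asym   : Asymmetric _⟶_

-- Unlike the library's Transitive, this only constrains triples of distinct vertices.
TransitiveDigraph : {A : Set} → Rel A 0ℓ → Set
TransitiveDigraph _⟶_ =
  ∀ {x y z} → x ≢ y → y ≢ z → x ≢ z → x ⟶ y → y ⟶ z → x ⟶ z

record DirectedPath {A : Set} (_⟶_ : Rel A 0ℓ) (m : ℕ) : Set where
  field
    vertex   : Fin (suc m) → A
    distinct : Injective _≡_ _≡_ vertex
    step     : (i : Fin m) → vertex (inject₁ i) ⟶ vertex (suc i)

  first last : A
  first = vertex zero
  last  = vertex (fromℕ m)

record DirectedCycle {A : Set} (_⟶_ : Rel A 0ℓ) : Set where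
  field
    {m}  : ℕ
    path : DirectedPath _⟶_ m
  open DirectedPath path
  field
    closing : last ⟶ first

-- As the vertices of the path are distinct, the subdigraph induced on
-- {v₁, …, vₙ} is, up to renaming vertices, the pullback of _⟶_ along i ↦ vᵢ.
record Shortcut {A : Set} (_⟶_ : Rel A 0ℓ) : Set where
  field
    {m}  : ℕ
    path : DirectedPath _⟶_ m
  open DirectedPath path
  field
    atLeast4      : 4 ≤ suc m
    shortcutEdge  : first ⟶ last
    nonTransitive : ¬ TransitiveDigraph (_⟶_ on vertex)

Acyclic : ∀ {G} → Orientation G → Set
Acyclic φ = ¬ DirectedCycle (Orientation._⟶_ φ)

SemiTransitive : ∀ {G} → Orientation G → Set
SemiTransitive φ = Acyclic φ × ¬ Shortcut (Orientation._⟶_ φ)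

SemiTransitivelyOrientable : Graph → Set₁
SemiTransitivelyOrientable G = Σ (Orientation G) SemiTransitive

module _ (G H : Graph) where
  private
    module G = Graph G
    module H = Graph H

    V : Set
    V = G.Vertex × H.Vertex

    enum : V ↔ Fin (G.order * H.order)
    enum = ↔-sym *↔× ↔-∘ (G.enumeration ×-↔ H.enumeration)

  tensor : Graph
  tensor = record
    { Vertex      = V
    ; order       = G.order * H.order
    ; enumeration = enum
    ; _∼_         = λ (u₁ , u₂) (v₁ , v₂) → u₁ G.∼ v₁ × u₂ H.∼ v₂
    ; _∼?_        = λ (u₁ , u₂) (v₁ , v₂) → (u₁ G.∼? v₁) ×-dec (u₂ H.∼? v₂)
    ; ∼-sym       = λ (p , q) → G.∼-sym p , H.∼-sym q
    ; ∼-irrefl    = λ { refl (p , _) → G.∼-irrefl refl p }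
    }

  lexicographic : Graph
  lexicographic = record
    { Vertex      = V
    ; order       = G.order * H.order
    ; enumeration = enum
    ; _∼_         = λ (u₁ , u₂) (v₁ , v₂) → u₁ G.∼ v₁ ⊎ (u₁ ≡ v₁ × u₂ H.∼ v₂)
    ; _∼?_        = λ (u₁ , u₂) (v₁ , v₂) →
                      (u₁ G.∼? v₁) ⊎-dec ((u₁ G.≟ v₁) ×-dec (u₂ H.∼? v₂))
    ; ∼-sym       = Sum.map G.∼-sym (λ (p , q) → sym p , H.∼-sym q)
    ; ∼-irrefl    = λ { refl → [ G.∼-irrefl refl , H.∼-irrefl refl ∘ proj₂ ]′ }
    }

  strong : Graph
  strong = record
    { Vertex      = V
    ; order       = G.order * H.order
    ; enumeration = enum
    ; _∼_         = λ (u₁ , u₂) (v₁ , v₂) →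
                      (u₁ ≡ v₁ × u₂ H.∼ v₂)
                      ⊎ (u₁ G.∼ v₁ × u₂ ≡ v₂)
                      ⊎ (u₁ G.∼ v₁ × u₂ H.∼ v₂)
    ; _∼?_        = λ (u₁ , u₂) (v₁ , v₂) →
                      ((u₁ G.≟ v₁) ×-dec (u₂ H.∼? v₂))
                      ⊎-dec (((u₁ G.∼? v₁) ×-dec (u₂ H.≟ v₂))
                      ⊎-dec ((u₁ G.∼? v₁) ×-dec (u₂ H.∼? v₂)))
    ; ∼-sym       = Sum.map (λ (p , q) → sym p , H.∼-sym q)
                      (Sum.map (λ (p , q) → G.∼-sym p , sym q)
                               (λ (p , q) → G.∼-sym p , H.∼-sym q))
    ; ∼-irrefl    = λ { refl (inj₁ (_ , q))        → H.∼-irrefl refl q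
                      ; refl (inj₂ (inj₁ (p , _))) → G.∼-irrefl refl p
                      ; refl (inj₂ (inj₂ (p , _))) → G.∼-irrefl refl p
                      }
    }

{-# OPTIONS --safe #-}
-- If φ is semi-transitive and v is a vertex, reversing the edges that lead from
-- an in-neighbour of v to an out-neighbour of v turns φ into a transitive
-- orientation of the neighbourhood of v: a failure of transitivity would be a
-- shortcut on v and three of its neighbours.  Now in a transitive orientation
-- the arcs x — y and y — z with x, z non-adjacent both enter or both leave y, so
-- the arcs alternate along any closed walk x₀ x₁ … in which no xᵢ is adjacent to
-- xᵢ₊₂, so it has even length.  In each of the three products some vertex
-- is adjacent to all vertices of such a walk of odd length: an induced 5-cycle in
-- K₂ · C₅, an induced 7-cycle in the strong square of the fan over the path P₄,
-- and a 9-step walk on a triangular prism in K₄ × K₄.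
module Submission where

open import Defs
open import Data.Fin using (Fin; zero; suc; inject₁; fromℕ; toℕ; #_)
import Data.Fin as Fin
import Data.Fin.Properties as Fin
open import Data.List using (List; []; _∷_)
open import Data.List.Membership.DecPropositional using (_∈?_)
open import Data.List.Membership.Propositional using (_∈_)
open import Data.List.Relation.Unary.All as All using ()
open import Data.Nat using (ℕ; zero; suc; _+_; _*_; _≤_; _<_; _<?_; z≤n; s≤s)
open import Data.Nat.DivMod using (_mod_)
open import Data.Nat.Properties
  using ( ≤-refl; ≤-trans; <-irrefl; <-asym; <-trans; <⇒≱; +-suc; +-monoʳ-≤
        ; m+n≤o⇒m≤o; m+n≤o⇒n≤o; allUpTo?; module ≤-Reasoning)
open import Data.Product using (_×_; _,_; proj₁; proj₂; ∃-syntax)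
open import Data.Product.Properties using (≡-dec)
open import Data.Sum using (_⊎_; inj₁; inj₂; [_,_]′)
import Data.Sum as Sum
open import Data.Vec using ([]; _∷_; lookup)
open import Data.Vec.Relation.Unary.All using ([]; _∷_)
open import Data.Vec.Relation.Unary.AllPairs using ([]; _∷_)
open import Data.Vec.Relation.Unary.Unique.Propositional using (Unique)
open import Data.Vec.Relation.Unary.Unique.Propositional.Properties using (lookup-injective)
open import Function using (_∘_; _on_; flip)
open import Function.Construct.Identity using (↔-id)
open import Level using (0ℓ)
open import Relation.Binary using (Rel; Decidable; Transitive)
open import Relation.Binary.PropositionalEquality using (_≡_; _≢_; refl; subst₂)
open import Relation.Nullary using (¬_; Dec; contradiction)
open import Relation.Nullary.Decidable using (_×-dec_; _⊎-dec_; ¬?; decidable-stable; True; toWitness)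

-- Semi-transitive orientations around a vertex.

module SemiTransitiveNeighbourhood {G : Graph} (φ : Orientation G) (semi : SemiTransitive φ) where
  open Graph G
  open Orientation φ

  ⟶⇒≢ : ∀ {x y} → x ⟶ y → x ≢ y
  ⟶⇒≢ x⟶x refl = asym x⟶x x⟶x

  ⟶⟶⇒≢ : ∀ {x y z} → x ⟶ y → y ⟶ z → x ≢ z
  ⟶⟶⇒≢ x⟶y y⟶x refl = asym x⟶y y⟶x

  no-3-cycle : ∀ {x y z} → x ⟶ y → y ⟶ z → ¬ z ⟶ x
  no-3-cycle {x} {y} {z} xy yz zx = proj₁ semi record
    { path    = record
      { vertex   = lookup (x ∷ y ∷ z ∷ [])
      ; distinct = lookup-injective
          ((⟶⇒≢ xy ∷ ⟶⟶⇒≢ xy yz ∷ []) ∷ (⟶⇒≢ yz ∷ []) ∷ [] ∷ []) _ _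
      ; step     = λ { zero → xy ; (suc zero) → yz }
      }
    ; closing = zx
    }

  module _ {a b c d} (ab : a ⟶ b) (bc : b ⟶ c) (cd : c ⟶ d) (ad : a ⟶ d) where

    private
      path₄ : DirectedPath _⟶_ 3
      path₄ = record
        { vertex   = lookup (a ∷ b ∷ c ∷ d ∷ [])
        ; distinct = lookup-injective unique _ _
        ; step     = λ { zero → ab ; (suc zero) → bc ; (suc (suc zero)) → cd }
        }
        where
        unique : Unique (a ∷ b ∷ c ∷ d ∷ [])
        unique = (⟶⇒≢ ab ∷ ⟶⟶⇒≢ ab bc ∷ ⟶⇒≢ ad ∷ [])
               ∷ (⟶⇒≢ bc ∷ ⟶⟶⇒≢ bc cd ∷ [])
               ∷ (⟶⇒≢ cd ∷ [])
               ∷ [] ∷ []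

      -- The absence of shortcuts only refutes non-transitivity, hence the double negation;
      -- decidable adjacency removes it in the two lemmas below.
      transitive₄ : ¬ ¬ TransitiveDigraph (_⟶_ on lookup (a ∷ b ∷ c ∷ d ∷ []))
      transitive₄ nontransitive = proj₂ semi record
        { path          = path₄
        ; atLeast4      = ≤-refl
        ; shortcutEdge  = ad
        ; nonTransitive = nontransitive
        }

    first∼third : a ∼ c
    first∼third = decidable-stable (a ∼? c) λ a≁c → transitive₄ λ transitive →
      a≁c (⟶⇒∼ (transitive {zero} {suc zero} {suc (suc zero)} (λ ()) (λ ()) (λ ()) ab bc))

    second∼fourth : b ∼ d
    second∼fourth = decidable-stable (b ∼? d) λ b≁d → transitive₄ λ transitive →
      b≁d (⟶⇒∼ (transitive {suc zero} {suc (suc zero)} {suc (suc (suc zero))} (λ ()) (λ ()) (λ ()) bc cd))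

  -- After the reversal, arcs between the two sides lead from out-neighbours of `v` to
  -- in-neighbours.
  data Reoriented (v x y : Vertex) : Set where
    outside  : v ⟶ x → v ⟶ y → x ⟶ y → Reoriented v x y
    inside   : x ⟶ v → y ⟶ v → x ⟶ y → Reoriented v x y
    reversed : v ⟶ x → y ⟶ v → y ⟶ x → Reoriented v x y

  reoriented-asym : ∀ {v x y} → Reoriented v x y → ¬ Reoriented v y x
  reoriented-asym (outside  _ _ xy)   (outside  _ _ yx)   = asym xy yx
  reoriented-asym (outside  vx _ _)   (inside   _ xv _)   = asym vx xv
  reoriented-asym (outside  vx _ _)   (reversed _ xv _)   = asym vx xv
  reoriented-asym (inside   xv _ _)   (outside  _ vx _)   = asym xv vx
  reoriented-asym (inside   _ _ xy)   (inside   _ _ yx)   = asym xy yx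
  reoriented-asym (inside   _ yv _)   (reversed vy _ _)   = asym yv vy
  reoriented-asym (reversed _ yv _)   (outside  vy _ _)   = asym yv vy
  reoriented-asym (reversed vx _ _)   (inside   _ xv _)   = asym vx xv
  reoriented-asym (reversed vx _ _)   (reversed _ xv _)   = asym vx xv

  -- In the four consistent cases `v`, `x`, `y`, `z` line up as a directed path whose ends are
  -- joined by an arc, with `x` and `z` two places apart. The other five put `y` on both sides of
  -- `v`.
  reoriented-trans∼ : ∀ {v x y z} → Reoriented v x y → Reoriented v y z → x ∼ z
  reoriented-trans∼ (outside  vx _ xy)  (outside  _ vz yz)  = second∼fourth vx xy yz vz
  reoriented-trans∼ (outside  vx _ xy)  (reversed _ zv zy)  = ∼-sym (first∼third zv vx xy zy)
  reoriented-trans∼ (inside   xv _ xy)  (inside   _ zv yz)  = first∼third xy yz zv xv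
  reoriented-trans∼ (reversed vx _ yx)  (inside   _ zv yz)  = ∼-sym (second∼fourth yz zv vx yx)
  reoriented-trans∼ (outside  _ vy _)   (inside   yv _ _)   = contradiction yv (asym vy)
  reoriented-trans∼ (inside   _ yv _)   (outside  vy _ _)   = contradiction yv (asym vy)
  reoriented-trans∼ (inside   _ yv _)   (reversed vy _ _)   = contradiction yv (asym vy)
  reoriented-trans∼ (reversed _ yv _)   (outside  vy _ _)   = contradiction yv (asym vy)
  reoriented-trans∼ (reversed _ yv _)   (reversed vy _ _)   = contradiction yv (asym vy)

  reorient : ∀ {v x y} → v ∼ x → v ∼ y → x ∼ y → Reoriented v x y ⊎ Reoriented v y x
  reorient v∼x v∼y x∼y with orient v∼x | orient v∼y | orient x∼y
  ... | inj₁ vx | inj₁ vy | inj₁ xy = inj₁ (outside vx vy xy)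
  ... | inj₁ vx | inj₁ vy | inj₂ yx = inj₂ (outside vy vx yx)
  ... | inj₂ xv | inj₂ yv | inj₁ xy = inj₁ (inside xv yv xy)
  ... | inj₂ xv | inj₂ yv | inj₂ yx = inj₂ (inside yv xv yx)
  -- An arc from an out-neighbour of `v` to an in-neighbour would close a directed triangle through
  -- `v`.
  ... | inj₁ vx | inj₂ yv | inj₁ xy = contradiction xy (no-3-cycle yv vx)
  ... | inj₁ vx | inj₂ yv | inj₂ yx = inj₁ (reversed vx yv yx)
  ... | inj₂ xv | inj₁ vy | inj₁ xy = inj₂ (reversed vy xv xy)
  ... | inj₂ xv | inj₁ vy | inj₂ yx = contradiction yx (no-3-cycle xv vy)

-- Odd closed walks in a neighbourhood as obstructions.

module _ (G : Graph) where
  open Graph G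

  -- x ≡ z is allowed: a walk may turn back along an edge.
  ChordlessStep : (v x y z : Vertex) → Set
  ChordlessStep v x y z = (v ∼ x × v ∼ y × v ∼ z) × x ∼ y × y ∼ z × ¬ x ∼ z

  chordlessStep? : ∀ v x y z → Dec (ChordlessStep v x y z)
  chordlessStep? v x y z =
    ((v ∼? x) ×-dec ((v ∼? y) ×-dec (v ∼? z))) ×-dec ((x ∼? y) ×-dec ((y ∼? z) ×-dec ¬? (x ∼? z)))

  -- The rim is a closed walk of odd length 1 + k * 2; indices above 2 + k * 2 are irrelevant.
  record OddWheel : Set where
    field
      hub     : Vertex
      k       : ℕ
      rim     : ℕ → Vertex
      closed₀ : rim (suc (k * 2)) ≡ rim 0
      closed₁ : rim (suc (suc (k * 2))) ≡ rim 1
      step    : ∀ {i} → i < suc (k * 2) → ChordlessStep hub (rim i) (rim (suc i)) (rim (suc (suc i)))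

  oddWheel : ∀ hub k rim → rim (suc (k * 2)) ≡ rim 0 → rim (suc (suc (k * 2))) ≡ rim 1 →
             {True (allUpTo? (λ i → chordlessStep? hub (rim i) (rim (suc i)) (rim (suc (suc i)))) (suc (k * 2)))} →
             OddWheel
  oddWheel hub k rim closed₀ closed₁ {steps} = record
    { hub = hub ; k = k ; rim = rim ; closed₀ = closed₀ ; closed₁ = closed₁ ; step = toWitness steps }

-- The induction takes two steps at a time, shifting `P` and `Q` by 2, so that their roles are
-- restored.
alternate : ∀ {P Q : ℕ → Set} k →
            (∀ {i} → i < suc (k * 2) → P i → Q (suc i)) →
            (∀ {i} → i < suc (k * 2) → Q i → P (suc i)) →
            P 0 → Q (suc (k * 2))
alternate         zero    f g p = f (s≤s z≤n) p
alternate {P} {Q} (suc k) f g p =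
  alternate {λ i → P (2 + i)} {λ i → Q (2 + i)} k
    (λ i< → f (s≤s (s≤s i<))) (λ i< → g (s≤s (s≤s i<)))
    (g (s≤s (s≤s z≤n)) (f (s≤s z≤n) p))

oddWheel⇒¬orientable : ∀ {G} → OddWheel G → ¬ SemiTransitivelyOrientable G
oddWheel⇒¬orientable {G} wheel (φ , semi) = [ ¬up₀ , ¬down₀ ]′ up₀⊎down₀
  where
  open Graph G
  open OddWheel wheel
  open SemiTransitiveNeighbourhood φ semi

  Up Down : ℕ → Set
  Up   i = Reoriented hub (rim i) (rim (suc i))
  Down i = Reoriented hub (rim (suc i)) (rim i)

  up⇒down : ∀ {i} → i < suc (k * 2) → Up i → Down (suc i)
  up⇒down i< up with step i<
  ... | (_ , v∼y , v∼z) , _ , y∼z , x≁z with reorient v∼y v∼z y∼z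
  ... | inj₁ yz = contradiction (reoriented-trans∼ up yz) x≁z
  ... | inj₂ zy = zy

  down⇒up : ∀ {i} → i < suc (k * 2) → Down i → Up (suc i)
  down⇒up i< down with step i<
  ... | (_ , v∼y , v∼z) , _ , y∼z , x≁z with reorient v∼y v∼z y∼z
  ... | inj₁ yz = yz
  ... | inj₂ zy = contradiction (∼-sym (reoriented-trans∼ zy down)) x≁z

  up₀⊎down₀ : Up 0 ⊎ Down 0
  up₀⊎down₀ with step (s≤s z≤n)
  ... | (v∼x , v∼y , _) , x∼y , _ = reorient v∼x v∼y x∼y

  ¬up₀ : ¬ Up 0
  -- After an odd number of alternations the arc points down, but `closed₀` and `closed₁` make it
  -- the initial arc again.
  ¬up₀ up = reoriented-asym up
    (subst₂ (flip (Reoriented hub)) closed₀ closed₁ (alternate {Up} {Down} k up⇒down down⇒up up))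

  ¬down₀ : ¬ Down 0
  ¬down₀ down = reoriented-asym
    (subst₂ (Reoriented hub) closed₀ closed₁ (alternate {Down} {Up} k down⇒up up⇒down down)) down

-- Orientations along a height function.

record AscendingDigraph (n : ℕ) : Set₁ where
  field
    _⟶_    : Rel (Fin n) 0ℓ
    _⟶?_   : Decidable _⟶_
    height : Fin n → ℕ
    ascend : ∀ {i j} → i ⟶ j → height i < height j

  underlying : Graph
  underlying = record
    { Vertex      = Fin n
    ; order       = n
    ; enumeration = ↔-id (Fin n)
    ; _∼_         = λ i j → i ⟶ j ⊎ j ⟶ i
    ; _∼?_        = λ i j → (i ⟶? j) ⊎-dec (j ⟶? i)
    ; ∼-sym       = Sum.swap
    ; ∼-irrefl    = λ { refl → [ (λ i⟶i → <-irrefl refl (ascend i⟶i))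
                               , (λ i⟶i → <-irrefl refl (ascend i⟶i)) ]′ }
    }

  orientation : Orientation underlying
  orientation = record
    { _⟶_    = _⟶_
    ; ⟶⇒∼    = inj₁
    ; orient = λ i∼j → i∼j
    ; asym   = λ i⟶j j⟶i → <-asym (ascend i⟶j) (ascend j⟶i)
    }

  climb : ∀ m (p : Fin (suc m) → Fin n) → (∀ i → p (inject₁ i) ⟶ p (suc i)) →
          m + height (p zero) ≤ height (p (fromℕ m))
  climb zero    p step = ≤-refl
  climb (suc m) p step = begin
    suc m + height (p zero)   ≡⟨ +-suc m _ ⟨
    m + suc (height (p zero)) ≤⟨ +-monoʳ-≤ m (ascend (step zero)) ⟩
    m + height (p (suc zero)) ≤⟨ climb m (p ∘ suc) (step ∘ suc) ⟩
    height (p (fromℕ (suc m))) ∎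
    where open ≤-Reasoning

  acyclic : Acyclic orientation
  acyclic record { m = m ; path = path ; closing = closing } =
    <⇒≱ (ascend closing) (m+n≤o⇒n≤o m (climb m vertex step))
    where open DirectedPath path

  transitive⇒orientable : Transitive _⟶_ → SemiTransitivelyOrientable underlying
  transitive⇒orientable ⟶-trans = orientation , acyclic , λ shortcut →
    Shortcut.nonTransitive shortcut (λ _ _ _ → ⟶-trans)

  -- Such heights form a proper 3-colouring, and 3-colourable graphs are semi-transitively
  -- orientable: the path of a shortcut has at least three arcs, so it would climb to height 3.
  flat⇒orientable : {True (Fin.all? λ i → height i <? 3)} → SemiTransitivelyOrientable underlying
  flat⇒orientable {flat} = orientation , acyclic , noShortcut
    where
    height<3 : ∀ i → height i < 3
    height<3 = toWitness flat

    noShortcut : ¬ Shortcut _⟶_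
    noShortcut record { m = m ; path = path ; atLeast4 = s≤s 3≤m } =
      <⇒≱ (height<3 last) (≤-trans 3≤m (m+n≤o⇒m≤o m (climb m vertex step)))
      where open DirectedPath path

-- The factor graphs.

arcDigraph : ∀ {n} (arcs : List (Fin n × Fin n)) (height : Fin n → ℕ) →
             {True (All.all? (λ (i , j) → height i <? height j) arcs)} → AscendingDigraph n
arcDigraph arcs height {ascending} = record
  { _⟶_    = λ i j → (i , j) ∈ arcs
  ; _⟶?_   = λ i j → _∈?_ (≡-dec Fin._≟_ Fin._≟_) (i , j) arcs
  ; height = height
  ; ascend = All.lookup (toWitness ascending)
  }

ascendingTournament : ∀ n → AscendingDigraph n
ascendingTournament n = record
  { _⟶_    = Fin._<_
  ; _⟶?_   = Fin._<?_
  ; height = toℕ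
  ; ascend = λ i<j → i<j
  }

K : ℕ → Graph
K n = AscendingDigraph.underlying (ascendingTournament n)

K-orientable : ∀ n → SemiTransitivelyOrientable (K n)
K-orientable n = AscendingDigraph.transitive⇒orientable (ascendingTournament n) <-trans

pentagon : AscendingDigraph 5
pentagon = arcDigraph
  -- Vertices 2 and 4 are sources, 1 and 3 sinks; 0 lies between, since an odd cycle cannot consist
  -- of sources and sinks only.
  ((# 0 , # 1) ∷ (# 2 , # 1) ∷ (# 2 , # 3) ∷ (# 4 , # 3) ∷ (# 4 , # 0) ∷ [])
  (lookup (1 ∷ 2 ∷ 0 ∷ 1 ∷ 0 ∷ []))

C₅ : Graph
C₅ = AscendingDigraph.underlying pentagon

C₅-orientable : SemiTransitivelyOrientable C₅
C₅-orientable = AscendingDigraph.flat⇒orientable pentagon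

-- Vertex 0 joined to the path 1 — 2 — 3 — 4.
fan : AscendingDigraph 5
fan = arcDigraph
  ( (# 0 , # 1) ∷ (# 0 , # 2) ∷ (# 0 , # 3) ∷ (# 0 , # 4)
  ∷ (# 1 , # 2) ∷ (# 3 , # 2) ∷ (# 3 , # 4) ∷ [])
  (lookup (0 ∷ 1 ∷ 2 ∷ 1 ∷ 2 ∷ []))

F : Graph
F = AscendingDigraph.underlying fan

F-orientable : SemiTransitivelyOrientable F
F-orientable = AscendingDigraph.flat⇒orientable fan

-- Odd wheels in the three products.

tensorWheel : OddWheel (tensor (K 4) (K 4))
tensorWheel = oddWheel _ (# 0 , # 0) 4 rim refl refl
  where
  -- The prism has the triangles 11, 22, 33 and 23, 31, 12; the walk goes around
  -- the first and makes a detour along a rung at each of its vertices.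
  rim : ℕ → Fin 4 × Fin 4
  rim i = lookup
    ( (# 1 , # 1) ∷ (# 2 , # 2) ∷ (# 3 , # 1)
    ∷ (# 2 , # 2) ∷ (# 3 , # 3) ∷ (# 1 , # 2)
    ∷ (# 3 , # 3) ∷ (# 1 , # 1) ∷ (# 2 , # 3) ∷ []) (i mod 9)

lexicographicWheel : OddWheel (lexicographic (K 2) C₅)
lexicographicWheel = oddWheel _ (# 0 , # 0) 2 rim refl refl
  where
  rim : ℕ → Fin 2 × Fin 5
  -- The copy of `C₅` over 1 is completely joined to the copy over 0, which contains the hub.
  rim i = # 1 , i mod 5

strongWheel : OddWheel (strong F F)
strongWheel = oddWheel _ (# 0 , # 0) 3 rim refl refl
  where
  rim : ℕ → Fin 5 × Fin 5
  -- Nonzero coordinates give the king's graph of a 4 × 4 board, all adjacent to the hub; the rim is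
  -- a ring around (2,2), (2,3) and (3,3).
  rim i = lookup
    ( (# 1 , # 2) ∷ (# 1 , # 3) ∷ (# 2 , # 4) ∷ (# 3 , # 4)
    ∷ (# 4 , # 3) ∷ (# 3 , # 2) ∷ (# 2 , # 1) ∷ []) (i mod 7)

mainTheorem7 : (∃[ G ] ∃[ H ] (SemiTransitivelyOrientable G × SemiTransitivelyOrientable H
    × ¬ SemiTransitivelyOrientable (tensor G H)))
    × (∃[ G ] ∃[ H ] (SemiTransitivelyOrientable G × SemiTransitivelyOrientable H
    × ¬ SemiTransitivelyOrientable (lexicographic G H)))
    × (∃[ G ] ∃[ H ] (SemiTransitivelyOrientable G × SemiTransitivelyOrientable H
    × ¬ SemiTransitivelyOrientable (strong G H)))
mainTheorem7 =
    (K 4 , K 4 , K-orientable 4 , K-orientable 4 , oddWheel⇒¬orientable tensorWheel)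
  , (K 2 , C₅  , K-orientable 2 , C₅-orientable  , oddWheel⇒¬orientable lexicographicWheel)
  , (F   , F   , F-orientable   , F-orientable   , oddWheel⇒¬orientable strongWheel)
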